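{- There exists an instance $\mathcal{I}$ of \textsc{Vector TSP} such that the optimal tour $\pi$ for the corresponding \textsc{Euclidean TSP} instance is suboptimal for $\mathcal{I}$; that is, no trajectory realizing the tour $\pi$ is an optimal solution of $\mathcal{I}$.
   Context: Racetrack model. Fix a dimension $d$. A configuration $c$ consists of a position $pos(c)\in\mathbb{Z}^d$ and a velocity $vel(c)\in\mathbb{Z}^d$. A configuration $c'$ is a successor of $c$ if every coordinate of $vel(c')-vel(c)$ has absolute value at most $1$ and $pos(c')=pos(c)+vel(c')$. A trajectory is a finite sequence of configurations $(c_1,\dots,c_k)$ in which $c_{i+1}$ is a successor of $c_i$ for all $i<k$; its length (cost) is $k$. A point $p$ is visited by a configuration $c$ if $p$ lies on the segment between $p_a=pos(c)-vel(c)$ and $p_b=pos(c)$; if several cities are visited by the same configuration, they are considered visited in increasing order of distance from $p_a$. It is allowed to pass over a city without counting this as its visit. \textsc{Vector TSP} (optimization version): given a finite set of cities $P\subseteq\mathbb{Z}^d$ (for some fixed $d$) and a distinguished city $p_0\in P$, find a trajectory of minimum length that visits all cities in $P$ and whose first and last configurations both have position $p_0$ and velocity $\vec 0$. A trajectory attaining this minimum is an optimal solution. A tour is an order of visit of the cities (starting from and returning to $p_0$); a trajectory realizes a tour $\pi$ if it starts and ends at $p_0$ with zero velocity and visits the cities in the order given by $\pi$. The corresponding \textsc{Euclidean TSP} instance has the same set of cities $P$, and asks for a closed tour minimizing the sum of Euclidean distances between consecutive cities. -}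

module Defs where

open import Data.Fin as Fin using (Fin)
open import Data.Integer as ℤ using (ℤ; 0ℤ; ∣_∣)
open import Data.List using (List; []; _∷_; _++_; [_]; head; last; length; lookup; map; reverse)
open import Data.List.Membership.Propositional using (_∈_)
open import Data.List.Relation.Binary.Permutation.Propositional using (_↭_)
open import Data.List.Relation.Unary.Linked using (Linked)
open import Data.List.Relation.Unary.Unique.Propositional using (Unique)
open import Data.Maybe using (just)
open import Data.Nat as ℕ using (ℕ)
open import Data.Product using (Σ; ∃; ∃-syntax; _×_)
open import Data.Rational as ℚ using (ℚ; 0ℚ; 1ℚ)
open import Data.Sum using (_⊎_)
open import Data.Vec as Vec using (Vec)
open import Relation.Binary.PropositionalEquality using (_≡_)
open import Relation.Nullary using (¬_)

-- A real number is represented by its lower Dedekind cut, i.e. by the set of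
-- rationals strictly below it.  Then x ≤ y is inclusion of cuts, and the cut
-- of x + y is the Minkowski sum of the two cuts.

ℝ : Set₁
ℝ = ℚ → Set

infix  4 _≤ᴿ_
infixl 6 _+ᴿ_

_≤ᴿ_ : ℝ → ℝ → Set
x ≤ᴿ y = ∀ q → x q → y q

0ᴿ : ℝ
0ᴿ q = q ℚ.< 0ℚ

_+ᴿ_ : ℝ → ℝ → ℝ
(x +ᴿ y) q = ∃[ r ] ∃[ s ] x r × y s × q ≡ r ℚ.+ s

√_ : ℕ → ℝ
(√ n) q = q ℚ.< 0ℚ ⊎ q ℚ.* q ℚ.< ℤ.+ n ℚ./ 1

Point : ℕ → Set
Point d = Vec ℤ d

origin : ∀ {d} → Point d
origin = Vec.replicate _ 0ℤ

infixl 6 _⊕_ _⊖_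

_⊕_ _⊖_ : ∀ {d} → Point d → Point d → Point d
_⊕_ = Vec.zipWith ℤ._+_
_⊖_ = Vec.zipWith ℤ._-_

dist : ∀ {d} → Point d → Point d → ℝ
dist p q = √ Vec.sum (Vec.map (λ z → ∣ z ∣ ℕ.^ 2) (p ⊖ q))

-- A real parameter t would give the same lattice points: if a ≢ b, some
-- coordinate forces t to be rational, and if a ≡ b any t will do.
OnSegment : ∀ {d} → Point d → Point d → Point d → Set
OnSegment {d} a b p =
  ∃[ t ] 0ℚ ℚ.≤ t × t ℚ.≤ 1ℚ ×
    (∀ (i : Fin d) →
      Vec.lookup p i ℚ./ 1 ≡
        Vec.lookup a i ℚ./ 1 ℚ.+ t ℚ.* (Vec.lookup (b ⊖ a) i ℚ./ 1))

record Configuration (d : ℕ) : Set where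
  constructor config
  field
    pos : Point d
    vel : Point d

  source : Point d
  source = pos ⊖ vel

open Configuration public

Successor : ∀ {d} → Configuration d → Configuration d → Set
Successor {d} c c′ =
  (∀ (i : Fin d) → ∣ Vec.lookup (vel c′ ⊖ vel c) i ∣ ℕ.≤ 1) ×
  pos c′ ≡ pos c ⊕ vel c′

record Trajectory (d : ℕ) : Set where
  field
    configs : List (Configuration d)
    linked  : Linked Successor configs

  cost : ℕ
  cost = length configs

open Trajectory public

VisitedBy : ∀ {d} → Point d → Configuration d → Set
VisitedBy p c = OnSegment (source c) (pos c) p

record Visit {d : ℕ} (τ : Trajectory d) : Set where
  field
    time : Fin (cost τ)

  by : Configuration d
  by = lookup (configs τ) time

  field
    place   : Point d
    visited : VisitedBy place by

open Visit public

_NotAfter_ : ∀ {d} {τ : Trajectory d} → Visit τ → Visit τ → Set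
v NotAfter w =
  time v Fin.< time w ⊎
  (time v ≡ time w ×
   dist (source (by v)) (place v) ≤ᴿ dist (source (by v)) (place w))

-- The cities visited, in this order.  The choice of visits is existential, so
-- that a trajectory may pass over a city without visiting it.
VisitsInOrder : ∀ {d} → Trajectory d → List (Point d) → Set
VisitsInOrder τ ps =
  Σ (List (Visit τ)) λ vs → map place vs ≡ ps × Linked _NotAfter_ vs

record Instance (d : ℕ) : Set where
  field
    cities : List (Point d)
    unique : Unique cities
    p₀     : Point d
    p₀∈    : p₀ ∈ cities

module _ {d : ℕ} (I : Instance d) where
  open Instance I

  StartsAndEndsAtRest : Trajectory d → Set
  StartsAndEndsAtRest τ =
    head (configs τ) ≡ just (config p₀ origin) ×
    last (configs τ) ≡ just (config p₀ origin)

  Solution : Trajectory d → Set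
  Solution τ =
    StartsAndEndsAtRest τ ×
    (∀ p → p ∈ cities → Σ (Fin (cost τ)) λ i → VisitedBy p (lookup (configs τ) i))

  OptimalSolution : Trajectory d → Set
  OptimalSolution τ = Solution τ × (∀ τ′ → Solution τ′ → cost τ ℕ.≤ cost τ′)

  record Tour : Set where
    field
      order    : List (Point d)
      complete : p₀ ∷ order ↭ cities

    closed : List (Point d)
    closed = p₀ ∷ order ++ [ p₀ ]

  open Tour

  Realizes : Trajectory d → Tour → Set
  Realizes τ π = StartsAndEndsAtRest τ × VisitsInOrder τ (closed π)

  pathLength : List (Point d) → ℝ
  pathLength (p ∷ q ∷ ps) = dist p q +ᴿ pathLength (q ∷ ps)
  pathLength _            = 0ᴿ

  EuclideanOptimal : Tour → Set
  EuclideanOptimal π = ∀ π′ → pathLength (closed π) ≤ᴿ pathLength (closed π′)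

  SameUpToDirection : Tour → Tour → Set
  SameUpToDirection π π′ = order π ≡ order π′ ⊎ order π ≡ reverse (order π′)

  Suboptimal : Tour → Set
  Suboptimal π = ∀ τ → Realizes τ π → ¬ OptimalSolution τ

{-# OPTIONS --safe #-}
module Submission where

-- Take p₀ = (0,0), a = (2,1), b = (3,2) and c = (4,1).  The tour a b c has length
-- √5 + 2√2 + √17 < 9.21 and any other, up to direction, at least
-- √5 + 2 + √2 + √13 > 9.24, but a c b can be driven with 9 configurations.
-- With at most 9, the only x-velocities that reach x = 4 and come back to rest
-- are 0,1,2,1,0,−1,−2,−1,0.  In the order a b c, both a and b are then visited on
-- the way out: a as the midpoint and b as the end of the step from x = 1 to x = 3.
-- This step starts from (1,0), so the y-velocity jumps from 0 to 2.  The case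
-- analysis is an enumeration: a trajectory is a pair of one-dimensional walks,
-- and only 77 walks of 8 steps start and end at rest at 0.

open import Defs
open import Data.Fin as Fin using (Fin; zero; suc)
import Data.Fin.Properties as Fin
open import Data.Integer as ℤ using (ℤ; 0ℤ; 1ℤ; -1ℤ; +_; -[1+_]; ∣_∣)
import Data.Integer.Properties as ℤ
open import Data.Integer.Tactic.RingSolver using (solve-∀)
open import Data.List using (List; []; _∷_; _++_; [_]; concatMap; last; length; lookup; map; reverse; upTo; zipWith)
open import Data.List.Membership.Propositional using (_∈_)
open import Data.List.Membership.Propositional.Properties using (∈-concatMap⁺; ∈-map⁺; ∈-upTo⁺)
open import Data.List.Properties using (last-map; length-map)
open import Data.List.Relation.Binary.Permutation.Propositional using (_↭_; prep; swap; ↭-refl; ↭-sym; ↭-trans)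
open import Data.List.Relation.Binary.Permutation.Propositional.Properties using (drop-∷; ↭-singleton-inv; ∈-resp-↭; ¬x∷xs↭[])
open import Data.List.Relation.Unary.All as All using (All; []; _∷_)
open import Data.List.Relation.Unary.Any as Any using (here; there)
open import Data.List.Relation.Unary.Linked as Linked using (Linked; []; [-]; _∷_; linked?)
import Data.List.Relation.Unary.Linked.Properties as Linked
open import Data.List.Relation.Unary.Unique.DecPropositional using (unique?)
open import Data.Maybe as Maybe using (just)
open import Data.Maybe.Properties using (just-injective)
open import Data.Nat as ℕ using (ℕ; zero; suc)
import Data.Nat.Properties as ℕ
open import Data.Product using (Σ; ∃₂; ∃-syntax; _×_; _,_; proj₁; proj₂)
import Data.Product.Properties as Product
open import Data.Rational as ℚ using (ℚ; mkℚ; 0ℚ; 1ℚ; ½; *≤*)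
import Data.Rational.Properties as ℚ
open import Data.Rational.Solver using (module +-*-Solver)
open import Data.Rational.Unnormalised as ℚᵘ using (mkℚᵘ; *≡*; _≃_)
import Data.Rational.Unnormalised.Properties as ℚᵘ
open import Data.Sum using (_⊎_; inj₁; inj₂; [_,_]′)
open import Data.Vec as Vec using ([]; _∷_)
import Data.Vec.Properties as Vec
open import Function using (_∘_)
open import Relation.Binary.PropositionalEquality using (_≡_; refl; sym; trans; cong; cong₂; subst; subst₂; module ≡-Reasoning)
open import Relation.Nullary using (Dec; yes; no; ¬_; ¬?; contradiction)
open import Relation.Nullary.Decidable using (_×-dec_; _⊎-dec_; True; toWitness; from-yes; from-no)
open import Algebra.Properties.AbelianGroup ℚ.+-0-abelianGroup using (//-rightDividesˡ; //-rightDividesʳ; xyx⁻¹≈y)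

-- Rational bounds on sums of cuts and on square roots

private variable
  x y z w : ℝ
  r s : ℚ

≤ᴿ-trans : x ≤ᴿ y → y ≤ᴿ z → x ≤ᴿ z
≤ᴿ-trans x≤y y≤z q = y≤z q ∘ x≤y q

real : ℚ → ℝ
real r q = q ℚ.< r

real-cancel-≤ : real r ≤ᴿ real s → r ℚ.≤ s
real-cancel-≤ {r} {s} r≤s = ℚ.≮⇒≥ λ s<r → ℚ.<-irrefl refl (r≤s s s<r)

real-mono-≤ : r ℚ.≤ s → real r ≤ᴿ real s
real-mono-≤ r≤s q q<r = ℚ.<-≤-trans q<r r≤s

+ᴿ-upper : x ≤ᴿ real r → y ≤ᴿ real s → (x +ᴿ y) ≤ᴿ real (r ℚ.+ s)
+ᴿ-upper x≤r y≤s _ (u , v , xu , yv , refl) = ℚ.+-mono-< (x≤r u xu) (y≤s v yv)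

-- Density of the rationals: choosing `u` strictly between `q - s` and `r` splits `q` as
-- `u + (q - u)` with `u < r` and `q - u < s`.
+ᴿ-lower : real r ≤ᴿ x → real s ≤ᴿ y → real (r ℚ.+ s) ≤ᴿ (x +ᴿ y)
+ᴿ-lower {r} {x} {s} r≤x s≤y q q<r+s
  with u , q-s<u , u<r ← ℚ.<-dense (subst (q ℚ.- s ℚ.<_) (//-rightDividesʳ s r) (ℚ.+-monoˡ-< (ℚ.- s) q<r+s)) =
  u , q ℚ.- u , r≤x u u<r , s≤y (q ℚ.- u) q-u<s , sym (trans (ℚ.+-comm u (q ℚ.- u)) (//-rightDividesˡ u q))
  where
  q-u<s : q ℚ.- u ℚ.< s
  q-u<s = subst (q ℚ.- u ℚ.<_) (xyx⁻¹≈y u s) (ℚ.+-monoˡ-< (ℚ.- u)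
    (subst (ℚ._< u ℚ.+ s) (//-rightDividesˡ s q) (ℚ.+-monoˡ-< s q-s<u)))

*-mono-square-≤ : ∀ {p q} → 0ℚ ℚ.≤ p → p ℚ.≤ q → p ℚ.* p ℚ.≤ q ℚ.* q
*-mono-square-≤ {p} {q} 0≤p p≤q = ℚ.≤-trans
  (ℚ.*-monoˡ-≤-nonNeg p {{ℚ.nonNegative 0≤p}} p≤q)
  (ℚ.*-monoʳ-≤-nonNeg q {{ℚ.nonNegative (ℚ.≤-trans 0≤p p≤q)}} p≤q)

√-upper : ∀ n r → 0ℚ ℚ.≤ r → + n ℚ./ 1 ℚ.≤ r ℚ.* r → (√ n) ≤ᴿ real r
√-upper n r 0≤r n≤r² q (inj₁ q<0)  = ℚ.<-≤-trans q<0 0≤r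
√-upper n r 0≤r n≤r² q (inj₂ q²<n) = ℚ.≰⇒> λ r≤q →
  ℚ.<-irrefl refl (ℚ.<-≤-trans q²<n (ℚ.≤-trans n≤r² (*-mono-square-≤ 0≤r r≤q)))

√-lower : ∀ n r → r ℚ.* r ℚ.≤ + n ℚ./ 1 → real r ≤ᴿ (√ n)
√-lower n r r²≤n q q<r with q ℚ.<? 0ℚ
... | yes q<0 = inj₁ q<0
... | no  q≮0 = inj₂ (ℚ.<-≤-trans (ℚ.≤-<-trans
  (ℚ.*-monoˡ-≤-nonNeg q {{ℚ.nonNegative 0≤q}} (ℚ.<⇒≤ q<r))
  (ℚ.*-monoˡ-<-pos r {{ℚ.positive (ℚ.≤-<-trans 0≤q q<r)}} q<r)) r²≤n)
  where 0≤q = ℚ.≮⇒≥ q≮0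

-- Serves tours driven backwards, whose distances compute to the same square roots in reverse order.
-- The rational summands are kept and only regrouped.
+ᴿ-reverse : ∀ x y z w → (x +ᴿ (y +ᴿ (z +ᴿ (w +ᴿ 0ᴿ)))) ≤ᴿ (w +ᴿ (z +ᴿ (y +ᴿ (x +ᴿ 0ᴿ))))
+ᴿ-reverse _ _ _ _ _ (r₁ , _ , x₁ , (r₂ , _ , y₂ , (r₃ , _ , z₃ , (r₄ , s , w₄ , 0s , refl) , refl) , refl) , refl) =
  r₄ , _ , w₄ , (r₃ , _ , z₃ , (r₂ , _ , y₂ , (r₁ , s , x₁ , 0s , refl) , refl) , refl) ,
  solve 5 (λ r₁ r₂ r₃ r₄ s → r₁ :+ (r₂ :+ (r₃ :+ (r₄ :+ s))) := r₄ :+ (r₃ :+ (r₂ :+ (r₁ :+ s))))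
    refl r₁ r₂ r₃ r₄ s
  where open +-*-Solver

√≤ : ∀ n r {_ : True (0ℚ ℚ.≤? r)} {_ : True (+ n ℚ./ 1 ℚ.≤? r ℚ.* r)} → (√ n) ≤ᴿ real r
√≤ n r {0≤r} {n≤r²} = √-upper n r (toWitness 0≤r) (toWitness n≤r²)

≤√ : ∀ n r {_ : True (r ℚ.* r ℚ.≤? + n ℚ./ 1)} → real r ≤ᴿ (√ n)
≤√ n r {r²≤n} = √-lower n r (toWitness r²≤n)

-- Permutations of two and three elements

↭-pair : ∀ {A : Set} {x y : A} {xs} → xs ↭ x ∷ y ∷ [] →
         xs ∈ (x ∷ y ∷ []) ∷ (y ∷ x ∷ []) ∷ []
↭-pair {xs = []} σ = contradiction (↭-sym σ) ¬x∷xs↭[]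
↭-pair {x = x} {y} {z ∷ xs} σ with ∈-resp-↭ σ (here refl)
... | here refl with refl ← ↭-singleton-inv (drop-∷ σ) = here refl
... | there (here refl)
  with refl ← ↭-singleton-inv (drop-∷ (↭-trans σ (swap x y ↭-refl))) = there (here refl)

orders : ∀ {A : Set} → A → A → A → List (List A)
orders x y z = (x ∷ y ∷ z ∷ []) ∷ (x ∷ z ∷ y ∷ []) ∷ (y ∷ x ∷ z ∷ []) ∷
               (y ∷ z ∷ x ∷ []) ∷ (z ∷ x ∷ y ∷ []) ∷ (z ∷ y ∷ x ∷ []) ∷ []

-- The head is one of the three elements; once it is swapped to the front on the right as well,
-- dropping it leaves a pair.
↭-triple : ∀ {A : Set} {x y z : A} {xs} → xs ↭ x ∷ y ∷ z ∷ [] → xs ∈ orders x y z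
↭-triple {xs = []} σ = contradiction (↭-sym σ) ¬x∷xs↭[]
↭-triple {x = x} {y} {z} {w ∷ xs} σ with ∈-resp-↭ σ (here refl)
... | here refl with ↭-pair (drop-∷ σ)
...   | here refl         = here refl
...   | there (here refl) = there (here refl)
↭-triple {x = x} {y} {z} σ | there (here refl)
  with ↭-pair (drop-∷ (↭-trans σ (swap x y ↭-refl)))
...   | here refl         = there (there (here refl))
...   | there (here refl) = there (there (there (here refl)))
↭-triple {x = x} {y} {z} σ | there (there (here refl))
  with ↭-pair (drop-∷ (↭-trans σ (↭-trans (prep x (swap y z ↭-refl)) (swap x z ↭-refl))))
...   | here refl         = there (there (there (there (here refl))))
...   | there (here refl) = there (there (there (there (there (here refl)))))

-- The instance and its Euclidean tours

p₀ a b c : Point 2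
p₀ = origin
a = + 2 ∷ + 1 ∷ []
b = + 3 ∷ + 2 ∷ []
c = + 4 ∷ + 1 ∷ []

I : Instance 2
I = record
  { cities = p₀ ∷ a ∷ b ∷ c ∷ []
  ; unique = from-yes (unique? (Vec.≡-dec ℤ._≟_) (p₀ ∷ a ∷ b ∷ c ∷ []))
  ; p₀     = p₀
  ; p₀∈    = here refl
  }

len : List (Point 2) → ℝ
len ps = pathLength I (p₀ ∷ ps ++ [ p₀ ])

-- One representative of each tour up to direction; the remaining three orders are the reversals.
abc acb bac : List (Point 2)
abc = a ∷ b ∷ c ∷ []
acb = a ∷ c ∷ b ∷ []
bac = b ∷ a ∷ c ∷ []

abc-upper : len abc ≤ᴿ real (+ 921 ℚ./ 100)
abc-upper =
  +ᴿ-upper (√≤ 5 (+ 224 ℚ./ 100)) (+ᴿ-upper (√≤ 2 (+ 142 ℚ./ 100))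
    (+ᴿ-upper (√≤ 2 (+ 142 ℚ./ 100)) (+ᴿ-upper (√≤ 17 (+ 413 ℚ./ 100)) λ _ q<0 → q<0)))

acb-lower : real (+ 924 ℚ./ 100) ≤ᴿ len acb
acb-lower =
  +ᴿ-lower (≤√ 5 (+ 223 ℚ./ 100)) (+ᴿ-lower (≤√ 4 (+ 2 ℚ./ 1))
    (+ᴿ-lower (≤√ 2 (+ 141 ℚ./ 100)) (+ᴿ-lower (≤√ 13 (+ 360 ℚ./ 100)) λ _ q<0 → q<0)))

bac-lower : real (+ 924 ℚ./ 100) ≤ᴿ len bac
-- The four bounds add up to 11.13, weakened to the threshold shared with `acb`.
bac-lower = ≤ᴿ-trans (real-mono-≤ (from-yes (+ 924 ℚ./ 100 ℚ.≤? + 1113 ℚ./ 100)))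
  (+ᴿ-lower (≤√ 13 (+ 360 ℚ./ 100)) (+ᴿ-lower (≤√ 2 (+ 141 ℚ./ 100))
    (+ᴿ-lower (≤√ 4 (+ 2 ℚ./ 1)) (+ᴿ-lower (≤√ 17 (+ 412 ℚ./ 100)) λ _ q<0 → q<0))))

-- The first half yields optimality of `abc`, the second its uniqueness up to direction.
Compared : List (Point 2) → Set
Compared o = len abc ≤ᴿ len o × (len o ≤ᴿ len abc → o ≡ abc ⊎ o ≡ reverse abc)

-- The gap between 9.21 and 9.24 gives the comparison and rules out a tie.
longer : ∀ o → real (+ 924 ℚ./ 100) ≤ᴿ len o → Compared o
longer o 924≤o =
  (λ q abc<q → 924≤o q (real-mono-≤ (from-yes (+ 921 ℚ./ 100 ℚ.≤? + 924 ℚ./ 100)) q (abc-upper q abc<q))) ,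
  λ o≤abc → contradiction (real-cancel-≤ λ q q<924 → abc-upper q (o≤abc q (924≤o q q<924)))
                           (from-no (+ 924 ℚ./ 100 ℚ.≤? + 921 ℚ./ 100))

compare : ∀ {o} → o ∈ orders a b c → Compared o
compare = All.lookup {P = Compared}
  ( ((λ _ abc<q → abc<q) , λ _ → inj₁ refl)
  ∷ longer acb acb-lower
  ∷ longer bac bac-lower
  ∷ longer (reverse acb) (λ q → +ᴿ-reverse (√ 5) (√ 4) (√ 2) (√ 13) q ∘ acb-lower q)
  ∷ longer (reverse bac) (λ q → +ᴿ-reverse (√ 13) (√ 2) (√ 4) (√ 17) q ∘ bac-lower q)
  ∷ (+ᴿ-reverse (√ 5) (√ 2) (√ 2) (√ 17) , λ _ → inj₂ refl)
  ∷ [])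

order∈orders : (π : Tour I) → Tour.order π ∈ orders a b c
order∈orders π = ↭-triple (drop-∷ (Tour.complete π))

πₑ : Tour I
πₑ = record { order = abc ; complete = ↭-refl }

πₑ-optimal : EuclideanOptimal I πₑ
πₑ-optimal π = proj₁ (compare (order∈orders π))

πₑ-unique : ∀ π → EuclideanOptimal I π → SameUpToDirection I π πₑ
πₑ-unique π optimal = proj₂ (compare (order∈orders π)) (optimal πₑ)

-- From segments to a decidable betweenness

-- Eliminating the parameter t makes this consequence of OnSegment decidable.
Between : ∀ {d} → Point d → Point d → Point d → Set
Between a b p =
  (∀ i → ∣ Vec.lookup p i ℤ.- Vec.lookup a i ∣ ℕ.+ ∣ Vec.lookup b i ℤ.- Vec.lookup p i ∣
           ≡ ∣ Vec.lookup b i ℤ.- Vec.lookup a i ∣) ×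
  (∀ i j → (Vec.lookup p i ℤ.- Vec.lookup a i) ℤ.* (Vec.lookup b j ℤ.- Vec.lookup p j)
             ≡ (Vec.lookup p j ℤ.- Vec.lookup a j) ℤ.* (Vec.lookup b i ℤ.- Vec.lookup p i))

between? : ∀ {d} (a b p : Point d) → Dec (Between a b p)
between? a b p =
  Fin.all? (λ i → _ ℕ.≟ _) ×-dec Fin.all? (λ i → Fin.all? λ j → _ ℤ.≟ _)

toℚᵘ-/1 : ∀ z → ℚ.toℚᵘ (z ℚ./ 1) ≃ mkℚᵘ z 0
toℚᵘ-/1 z = ℚ.toℚᵘ-fromℚᵘ (mkℚᵘ z 0)

-- Over unnormalised rationals equality is cross-multiplication, so the equation passes there and
-- turns into one between integers.
clear-denominator : ∀ p a v t →
  p ℚ./ 1 ≡ a ℚ./ 1 ℚ.+ t ℚ.* (v ℚ./ 1) →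
  ℚ.↧ t ℤ.* (p ℤ.- a) ≡ ℚ.↥ t ℤ.* v
clear-denominator p a v t@(mkℚ m n-1 _) eq = begin
  n ℤ.* (p ℤ.- a)                 ≡⟨ expand n p a ⟩
  p ℤ.* n ℤ.- n ℤ.* a             ≡⟨ cong (ℤ._- n ℤ.* a) (cleared unnormalised) ⟩
  n ℤ.* a ℤ.+ m ℤ.* v ℤ.- n ℤ.* a ≡⟨ collect n a (m ℤ.* v) ⟩
  m ℤ.* v                         ∎
  where
  open ≡-Reasoning
  n = + suc n-1
  unnormalised : mkℚᵘ p 0 ≃ mkℚᵘ a 0 ℚᵘ.+ ℚ.toℚᵘ t ℚᵘ.* mkℚᵘ v 0
  unnormalised =
    ℚᵘ.≃-trans (ℚᵘ.≃-sym (toℚᵘ-/1 p)) (ℚᵘ.≃-trans (ℚ.toℚᵘ-cong eq)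
      (ℚᵘ.≃-trans (ℚ.toℚᵘ-homo-+ (a ℚ./ 1) (t ℚ.* (v ℚ./ 1))) (ℚᵘ.+-cong (toℚᵘ-/1 a)
        (ℚᵘ.≃-trans (ℚ.toℚᵘ-homo-* t (v ℚ./ 1)) (ℚᵘ.*-cong (ℚᵘ.≃-refl {ℚ.toℚᵘ t}) (toℚᵘ-/1 v))))))
  cleared : mkℚᵘ p 0 ≃ mkℚᵘ a 0 ℚᵘ.+ ℚ.toℚᵘ t ℚᵘ.* mkℚᵘ v 0 → p ℤ.* n ≡ n ℤ.* a ℤ.+ m ℤ.* v
  -- The denominator on the right computes to the successor of `n-1 * 1 + 0`; the rewrites bring it
  -- back to `n`.
  cleared (*≡* e) rewrite ℕ.*-identityʳ n-1 | ℕ.+-identityʳ n-1 = trans e (tidy n a (m ℤ.* v))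
    where
    tidy : ∀ n a w → (a ℤ.* n ℤ.+ w ℤ.* 1ℤ) ℤ.* 1ℤ ≡ n ℤ.* a ℤ.+ w
    tidy = solve-∀
  expand : ∀ n p a → n ℤ.* (p ℤ.- a) ≡ p ℤ.* n ℤ.- n ℤ.* a
  expand = solve-∀
  collect : ∀ n a w → n ℤ.* a ℤ.+ w ℤ.- n ℤ.* a ≡ w
  collect = solve-∀

-- The parameter t of the segment is m / (m + k).
onSegment⇒ratio : ∀ {d} {a b p : Point d} → OnSegment a b p →
  ∃₂ λ m k → ℕ.NonZero (m ℕ.+ k) × ∀ i →
    + (m ℕ.+ k) ℤ.* (Vec.lookup p i ℤ.- Vec.lookup a i) ≡ + m ℤ.* (Vec.lookup b i ℤ.- Vec.lookup a i) ×
    + (m ℕ.+ k) ℤ.* (Vec.lookup b i ℤ.- Vec.lookup p i) ≡ + k ℤ.* (Vec.lookup b i ℤ.- Vec.lookup a i)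
onSegment⇒ratio (mkℚ -[1+ _ ] _ _ , *≤* () , _)
onSegment⇒ratio {a = a} {b} {p} (t@(mkℚ (+ m) n-1 _) , _ , *≤* m≤n , eq)
  -- `t ≤ 1` unfolds to `m * 1 ≤ 1 * n`, so the complementary weight `k = n - m` is a natural
  -- number.
  with k , m+k≡n ← ℕ.m≤n⇒∃[o]m+o≡n (ℤ.drop‿+≤+ (subst₂ ℤ._≤_ (ℤ.*-identityʳ (+ m)) (ℤ.*-identityˡ (+ suc n-1)) m≤n)) =
  m , k , subst ℕ.NonZero (sym m+k≡n) _ , λ i →
    let P = Vec.lookup p i; A = Vec.lookup a i; B = Vec.lookup b i
        to = begin
          + (m ℕ.+ k) ℤ.* (P ℤ.- A)     ≡⟨ cong (λ n → + n ℤ.* (P ℤ.- A)) m+k≡n ⟩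
          + suc n-1 ℤ.* (P ℤ.- A)       ≡⟨ clear-denominator P A _ t (eq i) ⟩
          + m ℤ.* Vec.lookup (b ⊖ a) i  ≡⟨ cong (+ m ℤ.*_) (Vec.lookup-zipWith ℤ._-_ i b a) ⟩
          + m ℤ.* (B ℤ.- A)             ∎
    in to , (begin
      + (m ℕ.+ k) ℤ.* (B ℤ.- P)                                   ≡⟨ split (+ (m ℕ.+ k)) P A B ⟩
      + (m ℕ.+ k) ℤ.* (B ℤ.- A) ℤ.- + (m ℕ.+ k) ℤ.* (P ℤ.- A)     ≡⟨ cong₂ (λ n x → n ℤ.* (B ℤ.- A) ℤ.- x) (ℤ.pos-+ m k) to ⟩
      (+ m ℤ.+ + k) ℤ.* (B ℤ.- A) ℤ.- + m ℤ.* (B ℤ.- A)           ≡⟨ cancel (+ m) (+ k) (B ℤ.- A) ⟩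
      + k ℤ.* (B ℤ.- A)                                           ∎)
  where
  open ≡-Reasoning
  split : ∀ n p a b → n ℤ.* (b ℤ.- p) ≡ n ℤ.* (b ℤ.- a) ℤ.- n ℤ.* (p ℤ.- a)
  split = solve-∀
  cancel : ∀ m k v → (m ℤ.+ k) ℤ.* v ℤ.- m ℤ.* v ≡ k ℤ.* v
  cancel = solve-∀

-- With `n = m + k`, both `n P = m V` and `n W = k V`. Absolute values then add up, and
-- `n² P i W j = m k V i V j` is symmetric in `i` and `j`.
onSegment⇒between : ∀ {d} {a b p : Point d} → OnSegment a b p → Between a b p
onSegment⇒between {d} {a} {b} {p} s with m , k , n≢0 , split ← onSegment⇒ratio {a = a} {b} {p} s = metric , collinear
  where
  n : ℕ
  n = m ℕ.+ k
  instance _ = n≢0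
  P V W : Fin d → ℤ
  P i = Vec.lookup p i ℤ.- Vec.lookup a i
  W i = Vec.lookup b i ℤ.- Vec.lookup p i
  V i = Vec.lookup b i ℤ.- Vec.lookup a i

  scaled : ∀ i c x → + n ℤ.* x ≡ + c ℤ.* V i → n ℕ.* ∣ x ∣ ≡ c ℕ.* ∣ V i ∣
  scaled i c x eq = begin
    n ℕ.* ∣ x ∣       ≡⟨ ℤ.abs-* (+ n) x ⟨
    ∣ + n ℤ.* x ∣     ≡⟨ cong ∣_∣ eq ⟩
    ∣ + c ℤ.* V i ∣   ≡⟨ ℤ.abs-* (+ c) (V i) ⟩
    c ℕ.* ∣ V i ∣     ∎
    where open ≡-Reasoning

  metric : ∀ i → ∣ P i ∣ ℕ.+ ∣ W i ∣ ≡ ∣ V i ∣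
  metric i = ℕ.*-cancelˡ-≡ _ _ n (begin
    n ℕ.* (∣ P i ∣ ℕ.+ ∣ W i ∣)         ≡⟨ ℕ.*-distribˡ-+ n (∣ P i ∣) _ ⟩
    n ℕ.* ∣ P i ∣ ℕ.+ n ℕ.* ∣ W i ∣     ≡⟨ cong₂ ℕ._+_ (scaled i m (P i) (proj₁ (split i))) (scaled i k (W i) (proj₂ (split i))) ⟩
    m ℕ.* ∣ V i ∣ ℕ.+ k ℕ.* ∣ V i ∣     ≡⟨ ℕ.*-distribʳ-+ (∣ V i ∣) m k ⟨
    n ℕ.* ∣ V i ∣                       ∎)
    where open ≡-Reasoning

  product : ∀ i j → + n ℤ.* (+ n ℤ.* (P i ℤ.* W j)) ≡ + m ℤ.* + k ℤ.* (V i ℤ.* V j)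
  product i j = begin
    + n ℤ.* (+ n ℤ.* (P i ℤ.* W j))         ≡⟨ shuffle (+ n) (+ n) (P i) (W j) ⟩
    (+ n ℤ.* P i) ℤ.* (+ n ℤ.* W j)         ≡⟨ cong₂ ℤ._*_ (proj₁ (split i)) (proj₂ (split j)) ⟩
    (+ m ℤ.* V i) ℤ.* (+ k ℤ.* V j)         ≡⟨ shuffle′ (+ m) (+ k) (V i) (V j) ⟩
    + m ℤ.* + k ℤ.* (V i ℤ.* V j)           ∎
    where
    open ≡-Reasoning
    shuffle : ∀ a b x y → a ℤ.* (b ℤ.* (x ℤ.* y)) ≡ (a ℤ.* x) ℤ.* (b ℤ.* y)
    shuffle = solve-∀
    shuffle′ : ∀ a b x y → (a ℤ.* x) ℤ.* (b ℤ.* y) ≡ a ℤ.* b ℤ.* (x ℤ.* y)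
    shuffle′ = solve-∀

  collinear : ∀ i j → P i ℤ.* W j ≡ P j ℤ.* W i
  collinear i j = ℤ.*-cancelˡ-≡ (+ n) _ _ (ℤ.*-cancelˡ-≡ (+ n) _ _
    (trans (product i j) (trans (cong (+ m ℤ.* + k ℤ.*_) (ℤ.*-comm (V i) (V j))) (sym (product j i)))))

-- One-dimensional walks ending at rest

State : Set
State = ℤ × ℤ

rest : State
rest = 0ℤ , 0ℤ

_≟ˢ_ : (s s′ : State) → Dec (s ≡ s′)
_≟ˢ_ = Product.≡-dec ℤ._≟_ ℤ._≟_

Step : State → State → Set
Step (x , v) (x′ , v′) = ∣ v′ ℤ.- v ∣ ℕ.≤ 1 × x′ ≡ x ℤ.+ v′

nexts : State → List State
nexts (x , v) = map (λ a → x ℤ.+ (v ℤ.+ a) , v ℤ.+ a) (-1ℤ ∷ 0ℤ ∷ 1ℤ ∷ [])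

stops : State → List (List State)
stops s with s ≟ˢ rest
... | yes _ = [ [ s ] ]
... | no  _ = []

-- The number counts steps, so each list has one more state: cost 9 means 8 steps.
walks : ℕ → State → List (List State)
walks zero    s = stops s
walks (suc n) s = map (s ∷_) (concatMap (walks n) (nexts s))

∈-stops : ∀ {s} → s ≡ rest → [ s ] ∈ stops s
∈-stops {s} s≡rest with s ≟ˢ rest
... | yes _ = here refl
... | no ¬r = contradiction s≡rest ¬r

∣i∣≤1⇒∈ : ∀ {i} → ∣ i ∣ ℕ.≤ 1 → i ∈ -1ℤ ∷ 0ℤ ∷ 1ℤ ∷ []
∣i∣≤1⇒∈ {+ 0}          _ = there (here refl)
∣i∣≤1⇒∈ {+ 1}          _ = there (there (here refl))
∣i∣≤1⇒∈ {+ suc (suc _)} (ℕ.s≤s ())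
∣i∣≤1⇒∈ { -[1+ 0 ]}   _ = here refl
∣i∣≤1⇒∈ { -[1+ suc _ ]} (ℕ.s≤s ())

∈-nexts : ∀ {s s′} → Step s s′ → s′ ∈ nexts s
∈-nexts {x , v} {_ , v′} (small , refl) =
  subst (λ w → (x ℤ.+ w , w) ∈ nexts (x , v)) (v+[w-v]≡w v v′)
    (∈-map⁺ (λ a → x ℤ.+ (v ℤ.+ a) , v ℤ.+ a) (∣i∣≤1⇒∈ small))
  where
  v+[w-v]≡w : ∀ v w → v ℤ.+ (w ℤ.- v) ≡ w
  v+[w-v]≡w = solve-∀

∈-walks : ∀ {s ss} → Linked Step (s ∷ ss) → last (s ∷ ss) ≡ just rest →
          (s ∷ ss) ∈ walks (length ss) s
∈-walks [-] eq = ∈-stops (just-injective eq)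
∈-walks {s} {s′ ∷ ss} (step ∷ steps) eq =
  ∈-map⁺ (s ∷_) (∈-concatMap⁺ (walks (length ss))
    (Any.map (λ { refl → ∈-walks steps eq }) (∈-nexts {s} step)))

-- Trajectories as pairs of walks, and the exhaustive check

join : State → State → Configuration 2
join (x , u) (y , v) = config (x ∷ y ∷ []) (u ∷ v ∷ [])

Passes : Point 2 → Configuration 2 → Set
Passes p c = Between (source c) (pos c) p

coordinate : ∀ {d} → Fin d → Configuration d → State
coordinate i k = Vec.lookup (pos k) i , Vec.lookup (vel k) i

-- Acceleration is bounded in each coordinate separately, which lets the two walks range
-- independently over one list.
successor⇒step : ∀ {d} {k k′ : Configuration d} i → Successor k k′ →
                 Step (coordinate i k) (coordinate i k′)
successor⇒step {k = k} {k′} i (small , moved) =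
  subst (λ δ → ∣ δ ∣ ℕ.≤ 1) (Vec.lookup-zipWith ℤ._-_ i (vel k′) (vel k)) (small i) ,
  trans (cong (λ p → Vec.lookup p i) moved) (Vec.lookup-zipWith ℤ._+_ i (pos k) (vel k′))

join-coordinates : ∀ cs → zipWith join (map (coordinate zero) cs) (map (coordinate (suc zero)) cs) ≡ cs
join-coordinates []                                      = refl
join-coordinates (config (_ ∷ _ ∷ []) (_ ∷ _ ∷ []) ∷ cs) = cong (_ ∷_) (join-coordinates cs)

coordinate-walk : ∀ {k cs} i → Linked (Successor {2}) (k ∷ cs) →
                  k ≡ config origin origin → last (k ∷ cs) ≡ just (config origin origin) →
                  map (coordinate i) (k ∷ cs) ∈ walks (length cs) rest
coordinate-walk {k} {cs} i linked refl end =
  subst₂ (λ n s → map (coordinate i) (k ∷ cs) ∈ walks n s) (length-map (coordinate i) cs) (at-rest i)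
    (∈-walks (Linked.map⁺ (Linked.map (successor⇒step i) linked))
      (trans (last-map (coordinate i) (k ∷ cs)) (trans (cong (Maybe.map (coordinate i)) end) (cong just (at-rest i)))))
  where
  -- `Vec.lookup` is stuck on a variable index, hence the case split.
  at-rest : ∀ i → coordinate i (config origin origin) ≡ rest
  at-rest zero       = refl
  at-rest (suc zero) = refl

-- The order of visits within one step is ignored, which only weakens the
-- predicate.  Looking for r first prunes the search when r is hard to reach.
InEitherOrder : Point 2 → Point 2 → Point 2 → List (Configuration 2) → Set
InEitherOrder p q r cs =
  ∃[ k ] Passes r (lookup cs k) ×
  ∃[ j ] Passes q (lookup cs j) ×
  ∃[ i ] Passes p (lookup cs i) ×
  ((i Fin.≤ j × j Fin.≤ k) ⊎ (k Fin.≤ j × j Fin.≤ i))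

inEitherOrder? : ∀ p q r cs → Dec (InEitherOrder p q r cs)
inEitherOrder? p q r cs =
  Fin.any? λ k → passes? r (lookup cs k) ×-dec
  Fin.any? λ j → passes? q (lookup cs j) ×-dec
  Fin.any? λ i → passes? p (lookup cs i) ×-dec
  ((i Fin.≤? j ×-dec j Fin.≤? k) ⊎-dec (k Fin.≤? j ×-dec j Fin.≤? i))
  where
  passes? : ∀ p k → Dec (Passes p k)
  passes? p k = between? (source k) (pos k) p

Infeasible : Point 2 → Point 2 → Point 2 → List (List State) → Set
Infeasible p q r ws = All (λ xs → All (λ ys → ¬ InEitherOrder p q r (zipWith join xs ys)) ws) ws

-- As a parameter, ws is evaluated once and not once for each xs.
infeasible? : ∀ p q r ws → Dec (Infeasible p q r ws)
infeasible? p q r ws =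
  All.all? (λ xs → All.all? (λ ys → ¬? (inEitherOrder? p q r (zipWith join xs ys))) ws) ws

infeasible : ∀ {n} → n ℕ.< 9 → Infeasible a b c (walks n rest)
infeasible n<9 = All.lookup
  -- All step counts from 0 to 8 are settled by evaluating the decision procedure.
  (toWitness {a? = All.all? (λ n → infeasible? a b c (walks n rest)) (upTo 9)} _) (∈-upTo⁺ n<9)

short⇒¬inEitherOrder : ∀ τ → StartsAndEndsAtRest I τ → cost τ ℕ.≤ 9 → ¬ InEitherOrder a b c (configs τ)
short⇒¬inEitherOrder record { configs = [] } (() , _)
short⇒¬inEitherOrder record { configs = k ∷ cs ; linked = linked } (start , end) short visits =
  -- The cost is `suc (length cs)`, so `short` is literally `length cs < 9`.
  All.lookup (All.lookup (infeasible short) (walk zero)) (walk (suc zero))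
    (subst (InEitherOrder a b c) (sym (join-coordinates (k ∷ cs))) visits)
  where
  walk : ∀ i → map (coordinate i) (k ∷ cs) ∈ walks (length cs) rest
  walk i = coordinate-walk i linked (just-injective start) end

-- Visits of a realizing trajectory

notAfter⇒≤ : ∀ {d} {τ : Trajectory d} (v w : Visit τ) → v NotAfter w → time v Fin.≤ time w
notAfter⇒≤ _ _ (inj₁ v<w)       = ℕ.<⇒≤ v<w
notAfter⇒≤ _ _ (inj₂ (v≡w , _)) = ℕ.≤-reflexive (cong Fin.toℕ v≡w)

passes : ∀ {τ : Trajectory 2} (v : Visit τ) → Passes (place v) (by v)
passes v = onSegment⇒between {a = source (by v)} {pos (by v)} {place v} (visited v)

-- Both readings are supplied because a Euclidean-optimal tour may run as `abc` or backwards, while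
-- the check is made for `a b c` alone. The end visits are discarded.
visitsInOrder⇒inEitherOrder : ∀ (τ : Trajectory 2) {o p q r e} →
  VisitsInOrder τ (o ∷ p ∷ q ∷ r ∷ e ∷ []) →
  InEitherOrder p q r (configs τ) × InEitherOrder r q p (configs τ)
visitsInOrder⇒inEitherOrder τ (_ ∷ u ∷ v ∷ w ∷ _ ∷ [] , refl , _ ∷ u≤v ∷ v≤w ∷ _) =
  (time w , passes w , time v , passes v , time u , passes u , inj₁ (i≤j , j≤k)) ,
  (time u , passes u , time v , passes v , time w , passes w , inj₂ (i≤j , j≤k))
  where
  i≤j = notAfter⇒≤ u v u≤v
  j≤k = notAfter⇒≤ v w v≤w

-- A solution of cost 9

successor? : ∀ {d} (k k′ : Configuration d) → Dec (Successor k k′)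
successor? k k′ = Fin.all? (λ i → _ ℕ.≤? 1) ×-dec Vec.≡-dec ℤ._≟_ _ _

-- Drives `p₀ a c b p₀`; it serves to bound the optimal cost by 9.
best : Trajectory 2
best = record { configs = path ; linked = from-yes (linked? successor? path) }
  where
  path : List (Configuration 2)
  path =
    config (+ 0 ∷ + 0 ∷ []) (+ 0 ∷ + 0 ∷ []) ∷
    config (+ 1 ∷ + 1 ∷ []) (+ 1 ∷ + 1 ∷ []) ∷
    config (+ 3 ∷ + 1 ∷ []) (+ 2 ∷ + 0 ∷ []) ∷
    config (+ 4 ∷ + 1 ∷ []) (+ 1 ∷ + 0 ∷ []) ∷
    config (+ 4 ∷ + 2 ∷ []) (+ 0 ∷ + 1 ∷ []) ∷
    config (+ 3 ∷ + 2 ∷ []) (-[1+ 0 ] ∷ + 0 ∷ []) ∷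
    config (+ 1 ∷ + 1 ∷ []) (-[1+ 1 ] ∷ -[1+ 0 ] ∷ []) ∷
    config (+ 0 ∷ + 0 ∷ []) (-[1+ 0 ] ∷ -[1+ 0 ] ∷ []) ∷
    config (+ 0 ∷ + 0 ∷ []) (+ 0 ∷ + 0 ∷ []) ∷ []

best-solution : Solution I best
best-solution = (refl , refl) , λ _ → All.lookup visits
  where
  visit : ∀ p i t
    {_ : True (0ℚ ℚ.≤? t)} {_ : True (t ℚ.≤? 1ℚ)}
    {_ : True (Fin.all? λ j → let k = lookup (configs best) i in
                 Vec.lookup p j ℚ./ 1 ℚ.≟
                 Vec.lookup (source k) j ℚ./ 1 ℚ.+ t ℚ.* (Vec.lookup (pos k ⊖ source k) j ℚ./ 1))} →
    Σ (Fin 9) λ i → VisitedBy p (lookup (configs best) i)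
  visit p i t {0≤t} {t≤1} {eqs} = i , t , toWitness 0≤t , toWitness t≤1 , toWitness eqs

  visits : All (λ p → Σ (Fin 9) λ i → VisitedBy p (lookup (configs best) i)) (p₀ ∷ a ∷ b ∷ c ∷ [])
  -- `a` is the midpoint of the step from (1,1) to (3,1), hence ½; `c` and `b` are ends of steps.
  visits = visit p₀ (Fin.# 0) 0ℚ ∷ visit a (Fin.# 2) ½ ∷ visit b (Fin.# 5) 1ℚ ∷ visit c (Fin.# 3) 1ℚ ∷ []

-- Suboptimality of the Euclidean tour

suboptimal : ∀ π → EuclideanOptimal I π → Suboptimal I π
suboptimal π optimal τ (atRest , visits) (_ , minimal) =
  -- An optimal `τ` costs at most as much as `best`, so it falls within the exhaustive check.
  short⇒¬inEitherOrder τ atRest (minimal best best-solution)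
    ([ (λ o≡abc → proj₁ (inEitherOrder o≡abc)) , (λ o≡cba → proj₂ (inEitherOrder o≡cba)) ]′
      (πₑ-unique π optimal))
  where
  inEitherOrder : ∀ {p q r} → Tour.order π ≡ p ∷ q ∷ r ∷ [] →
    InEitherOrder p q r (configs τ) × InEitherOrder r q p (configs τ)
  inEitherOrder eq = visitsInOrder⇒inEitherOrder τ
    (subst (λ o → VisitsInOrder τ (p₀ ∷ o ++ [ p₀ ])) eq visits)

lemma1 : Σ ℕ λ d → Σ (Instance d) λ I →
    (Σ (Tour I) λ π →
    EuclideanOptimal I π ×
    (∀ π′ → EuclideanOptimal I π′ → SameUpToDirection I π′ π)) ×
    (∀ π → EuclideanOptimal I π → Suboptimal I π)
lemma1 = 2 , I , (πₑ , πₑ-optimal , πₑ-unique) , suboptimal
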